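{- Let $N\ge 2$ and $m\ge 1$ be integers and let $x^{(r,s)}_k$ ($1\le r,s\le N$, $1\le k\le m$) be elements of a commutative ring; set $x^{(r,s)}_{m+1}=0$ for all $1\le r,s\le N$. Let $F(N,m)$ be the $Nm\times Nm$ matrix which, as an $N\times N$ block matrix with $m\times m$ blocks, has $(r,s)$ block $B_m(x^{(r,s)}_1,\dots,x^{(r,s)}_m)$ if $r$ is odd and $D_m(x^{(r,s)}_1,\dots,x^{(r,s)}_m)$ if $r$ is even. Then $$\det(F(N,m))=\begin{cases}(-1)^{\frac{Nm}{4}}\prod_{i=1}^{m}\det(X_{(i,i+1)}), & N \text{ even},\ m \text{ even},\\[2pt] (-1)^{\frac{N(m-1)}{4}}\prod_{i=1}^{m}\det(X_{(i,i+1)}), & N \text{ even},\ m \text{ odd},\\[2pt] (-1)^{\frac{(N-1)m}{4}}\prod_{i=1}^{m}\det(X_{(i,i+1)}), & N \text{ odd},\ m \text{ even},\\[2pt] (-1)^{\frac{(N-1)(m-1)}{4}}\prod_{i=1}^{m}\det(X_{(i,i+1)}), & N \text{ odd},\ m \text{ odd}.\end{cases}$$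
   Context: For elements $x_1,\dots,x_m$: $B_m(x_1,\dots,x_m)$ is the $m\times m$ matrix with $(p,q)$ entry $x_{\max(p,q)}$, and $D_m(x_1,\dots,x_m)$ is the $m\times m$ matrix with $(p,q)$ entry $x_{\max(m+1-p,\,q)}$. For $1\le i\le m$, $X_{(i,i+1)}$ is the $N\times N$ matrix whose $(r,s)$ entry is $x^{(r,s)}_i-x^{(r,s)}_{i+1}$. -}

open import Algebra.Bundles using (CommutativeRing)

-- Indices are 0-based: the element i of Fin n stands for the index i + 1 ∈ {1, …, n}.
module Defs where

module BlockDet {c ℓ} (R : CommutativeRing c ℓ) where

  import Algebra.Construct.NaturalChoice.Max as Max
  open import Data.Bool.Base using (if_then_else_)
  open import Data.Fin.Base using (Fin; zero; suc; toℕ; fromℕ; inject₁; opposite; punchIn; remQuot)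
  open import Data.Fin.Properties using (≤-totalOrder)
  open import Data.Nat.Base as ℕ using (ℕ; zero; suc)
  open import Data.Nat.Divisibility using (_∣?_)
  open import Data.Product.Base using (proj₁; proj₂)
  open import Data.Vec.Functional using (Vector; insertAt)
  open import Relation.Nullary.Decidable.Core using (does)

  open CommutativeRing R hiding (zero)
  open import Algebra.Properties.Semiring.Exp semiring public using (_^_)
  open import Algebra.Properties.CommutativeMonoid.Sum +-commutativeMonoid using (sum)
  open import Algebra.Properties.CommutativeMonoid.Sum *-commutativeMonoid public
    using () renaming (sum to ∏)

  SquareMatrix : ℕ → Set c
  SquareMatrix n = Fin n → Fin n → Carrier

  minor₀ : ∀ {n} → SquareMatrix (suc n) → Fin (suc n) → SquareMatrix n
  minor₀ A j p q = A (suc p) (punchIn j q)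

  -- Cofactor expansion along the first row.  The sign (-1)^(1 + (j + 1)) of the
  -- entry in 0-based column j is (-1)^j.
  det : ∀ {n} → SquareMatrix n → Carrier
  det {zero}  A = 1#
  det {suc n} A = sum λ j → (- 1#) ^ toℕ j * (A zero j * det (minor₀ A j))

  max : ∀ {n} → Fin n → Fin n → Fin n
  max {n} = Max._⊔_ (≤-totalOrder n)

  B : ∀ {m} → Vector Carrier m → SquareMatrix m
  B x p q = x (max p q)

  -- opposite sends the 1-based index p to m + 1 - p.
  D : ∀ {m} → Vector Carrier m → SquareMatrix m
  D x p q = x (max (opposite p) q)

  -- Appends the convention x_{m+1} = 0.
  extend : ∀ {m} → Vector Carrier m → Vector Carrier (suc m)
  extend {m} x = insertAt x (fromℕ m) 0#

  X : ∀ {N m} → (Fin N → Fin N → Vector Carrier m) → Fin m → SquareMatrix N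
  X x i r s = extend (x r s) (inject₁ i) - extend (x r s) (suc i)

  block : ∀ {N m} → (Fin N → Fin N → Vector Carrier m) → Fin N → Fin N → SquareMatrix m
  block x r s = if does (2 ∣? suc (toℕ r)) then D (x r s) else B (x r s)

  -- The row index k : Fin (N * m) is r * m + p with r : Fin N the block row
  -- and p : Fin m the row inside the block; likewise for columns.
  F : ∀ N m → (Fin N → Fin N → Vector Carrier m) → SquareMatrix (N ℕ.* m)
  F N m x k l =
    block x (proj₁ (remQuot {N} m k)) (proj₁ (remQuot {N} m l))
            (proj₂ (remQuot {N} m k)) (proj₂ (remQuot {N} m l))

{-# OPTIONS --safe #-}

-- With U the m × m matrix [p ≤ k], telescoping gives B(x) = U diag(xₖ - xₖ₊₁) Uᵀ, and reversing
-- the rows of U gives D(x) = U′ diag(xₖ - xₖ₊₁) Uᵀ.  Hence F(N, m) is the product of a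
-- block-diagonal matrix with blocks U and U′ alternately, of the matrix with diagonal blocks
-- diag(xₖ^{(r,s)} - xₖ₊₁^{(r,s)}), and of I ⊗ Uᵀ.  Simultaneously permuting rows and columns, the
-- middle factor becomes block diagonal with blocks X_{(k,k+1)}; det U = 1 and
-- det U′ = (-1)^⌊m/2⌋, so the sign is (-1)^(⌊m/2⌋⌊N/2⌋).
-- The determinant calculus all rests on one fact: a row-multilinear form f that vanishes
-- on matrices with two equal adjacent rows satisfies f(A) = f(I) det(A).
module Submission where

open import Defs
open import Algebra.Bundles using (CommutativeRing)
open import Data.Fin.Base using (Fin)
open import Data.Nat.Base as ℕ using (ℕ; _≤_; _∸_; _/_)
open import Data.Nat.Divisibility using (_∣_)
open import Data.Product.Base using (_×_)
open import Data.Vec.Functional using (Vector)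
open import Relation.Nullary.Negation.Core using (¬_)

import Algebra.Construct.NaturalChoice.Max as Max
open import Data.Bool.Base using (if_then_else_; true; false)
open import Data.Fin.Base using (zero; suc; toℕ; fromℕ; inject₁; opposite; punchIn; punchOut;
  splitAt; _↑ˡ_; _↑ʳ_; remQuot; combine)
open import Data.Fin.Induction using (<-weakInduction)
open import Data.Fin.Properties as Fin using ()
open import Data.Nat.Base using (zero; suc; ⌊_/2⌋)
open import Data.Nat.Divisibility using (_∣?_; divides)
open import Data.Nat.DivMod using (/-congˡ; m*n/n≡m)
import Data.Nat.Properties as ℕ
open import Data.Nat.Solver using (module +-*-Solver)
open import Data.Product.Base using (∃₂; _,_; proj₁; proj₂)
open import Data.Sum.Base as Sum using (_⊎_; inj₁; inj₂)
open import Data.Vec.Functional using (_∷_; insertAt; updateAt)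
open import Data.Vec.Functional.Properties
  using (insertAt-lookup; insertAt-punchIn; updateAt-updates; updateAt-minimal)
open import Function.Base using (_∘_; const; flip)
open import Level using (_⊔_)
open import Relation.Binary.PropositionalEquality.Core as ≡ using (_≡_; _≢_)
open import Relation.Nullary.Decidable.Core using (yes; no; does)
open import Relation.Nullary.Negation.Core using (contradiction)

-- In the ring, 2 may be a zero divisor, so alternation means vanishing on equal rows; the sign of a
-- row exchange is derived from it. Vanishing is asked for adjacent rows alone, because that is what
-- a cofactor expansion yields directly: two deletions next to each other leave the same minor with
-- opposite signs. Expansion along the first row treats the first row unlike the others but all
-- columns alike, so alternation is established for the determinant of the transpose. Uniqueness of
-- alternating forms rests on the recursion defining `det`, so it can be applied to that form
-- without circularity; it identifies the form with `det` and then gives multiplicativity.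
-- Permutations of rows and columns are handled through `det P * det (flip P) ≈ 1#`, so no sign of a
-- permutation is ever computed. The four exponents of the theorem are one number: rounding `N` and
-- `m` down to even numbers gives twice their halves, whose product is four times the product of the
-- halves.

-- Adjacent and deleted indices

data Adjacent : ∀ {n} → Fin n → Fin n → Set where
  here  : ∀ {n} → Adjacent {suc (suc n)} zero (suc zero)
  there : ∀ {n} {i j : Fin n} → Adjacent i j → Adjacent (suc i) (suc j)

adjacent-inject₁-suc : ∀ {n} (i : Fin n) → Adjacent (inject₁ i) (suc i)
adjacent-inject₁-suc zero    = here
adjacent-inject₁-suc (suc i) = there (adjacent-inject₁-suc i)

adjacent⇒≢ : ∀ {n} {i j : Fin n} → Adjacent i j → i ≢ j
adjacent⇒≢ (there a) ≡.refl = adjacent⇒≢ a ≡.refl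

-- Nothing lies between `i` and `j`, so deleting a third index `k` cannot separate them. Hence a
-- minor that keeps both of two equal adjacent rows still has them adjacent.
adjacent-punchOut : ∀ {n} {i j : Fin (suc n)} → Adjacent i j → ∀ {k} → k ≢ i → k ≢ j →
  ∃₂ λ i′ j′ → Adjacent i′ j′ × punchIn k i′ ≡ i × punchIn k j′ ≡ j
adjacent-punchOut here {zero} k≢i _ = contradiction ≡.refl k≢i
adjacent-punchOut here {suc zero} _ k≢j = contradiction ≡.refl k≢j
adjacent-punchOut here {suc (suc zero)} _ _ = zero , suc zero , here , ≡.refl , ≡.refl
adjacent-punchOut here {suc (suc (suc _))} _ _ = zero , suc zero , here , ≡.refl , ≡.refl
adjacent-punchOut (there a) {zero} _ _ = _ , _ , a , ≡.refl , ≡.refl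
adjacent-punchOut {suc n} (there a) {suc k} k≢i k≢j
  with i′ , j′ , a′ , p , q ← adjacent-punchOut a {k} (k≢i ∘ ≡.cong suc) (k≢j ∘ ≡.cong suc)
  = suc i′ , suc j′ , there a′ , ≡.cong suc p , ≡.cong suc q

-- A case split on `q ≡ j` whose second case already presents `q` as `punchIn j _`, the form in
-- which `insertAt` and deletion compute.
data PunchView {n} (j : Fin (suc n)) : Fin (suc n) → Set where
  at  : PunchView j j
  off : ∀ q → PunchView j (punchIn j q)

punchView : ∀ {n} (j q : Fin (suc n)) → PunchView j q
punchView j q with j Fin.≟ q
... | yes ≡.refl = at
... | no j≢q     = ≡.subst (PunchView j) (Fin.punchIn-punchOut j≢q) (off (punchOut j≢q))

module Determinant {c ℓ} (R : CommutativeRing c ℓ) where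

  open CommutativeRing R hiding (zero)
  open BlockDet R
  open import Algebra.Properties.Semiring.Sum semiring
    using (sum; sum-cong-≋; sum-replicate-zero; ∑-distrib-+; *-distribˡ-sum; *-distribʳ-sum)
  open import Algebra.Properties.Semiring.Exp semiring using (^-assocʳ)
  open import Algebra.Properties.Ring ring
    using (-1*x≈-x; -‿distribˡ-*; -‿distribʳ-*; -‿involutive; -0#≈0#; +-inverseˡ-unique)
  open import Data.Vec.Functional.Relation.Binary.Equality.Setoid setoid using (_≋_)
  open import Algebra.Solver.Ring.NaturalCoefficients.Default commutativeSemiring
    using (solve; _:=_; _:+_; _:*_)
  open import Relation.Binary.Reasoning.Setoid setoid

  -- Matrices as families of rows, and finite sums

  Rows : ℕ → ℕ → Set c
  Rows m n = Vector (Vector Carrier n) m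

  -- Sealed, since unification cannot invert the fold underlying sum.
  abstract

    ∑ : ∀ {n} → Vector Carrier n → Carrier
    ∑ = sum

    ∑-empty : (t : Vector Carrier 0) → ∑ t ≈ 0#
    ∑-empty t = refl

    ∑-suc : ∀ {n} (t : Vector Carrier (suc n)) → ∑ t ≈ t zero + ∑ (t ∘ suc)
    ∑-suc t = refl

    ∑-cong : ∀ {n} {s t : Vector Carrier n} → s ≋ t → ∑ s ≈ ∑ t
    ∑-cong = sum-cong-≋

    ∑-zero : ∀ {n} {t : Vector Carrier n} → (∀ i → t i ≈ 0#) → ∑ t ≈ 0#
    ∑-zero {n} {t} t≈0 = trans (sum-cong-≋ {n} {t} {λ _ → 0#} t≈0) (sum-replicate-zero n)

    ∑-+ : ∀ {n} (s t : Vector Carrier n) → ∑ (λ i → s i + t i) ≈ ∑ s + ∑ t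
    ∑-+ = ∑-distrib-+

    *-∑ : ∀ {n} a (t : Vector Carrier n) → a * ∑ t ≈ ∑ (λ i → a * t i)
    *-∑ = *-distribˡ-sum

    ∑-* : ∀ {n} a (t : Vector Carrier n) → ∑ t * a ≈ ∑ (λ i → t i * a)
    ∑-* = *-distribʳ-sum

    det-expand : ∀ {n} (A : SquareMatrix (suc n)) →
      det A ≈ ∑ λ j → (- 1#) ^ toℕ j * (A zero j * det (minor₀ A j))
    det-expand A = refl

  ∑-single : ∀ {n} (t : Vector Carrier n) i → (∀ {k} → k ≢ i → t k ≈ 0#) → ∑ t ≈ t i
  ∑-single t zero    t≈0 = trans (∑-suc t) (trans (+-congˡ (∑-zero λ k → t≈0 λ ())) (+-identityʳ _))
  ∑-single t (suc i) t≈0 = begin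
    ∑ t ≈⟨ ∑-suc t ⟩
    t zero + ∑ (t ∘ suc) ≈⟨ +-cong (t≈0 λ ()) (∑-single (t ∘ suc) i λ k≢i → t≈0 (k≢i ∘ Fin.suc-injective)) ⟩
    0# + t (suc i)         ≈⟨ +-identityˡ _ ⟩
    t (suc i)              ∎

  ∑-adjacent : ∀ {n} (t : Vector Carrier n) {i j} → Adjacent i j →
    (∀ {k} → k ≢ i → k ≢ j → t k ≈ 0#) → ∑ t ≈ t i + t j
  ∑-adjacent t here t≈0 = trans (∑-suc t) (+-congˡ (∑-single (t ∘ suc) zero
    λ k≢0 → t≈0 (λ ()) (k≢0 ∘ Fin.suc-injective)))
  ∑-adjacent t (there {i = i} {j} a) t≈0 = begin
    ∑ t ≈⟨ ∑-suc t ⟩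
    t zero + ∑ (t ∘ suc)         ≈⟨ +-cong (t≈0 (λ ()) λ ()) (∑-adjacent (t ∘ suc) a
      λ k≢i k≢j → t≈0 (k≢i ∘ Fin.suc-injective) (k≢j ∘ Fin.suc-injective)) ⟩
    0# + (t (suc i) + t (suc j))   ≈⟨ +-identityˡ _ ⟩
    t (suc i) + t (suc j)          ∎

  -- The Kronecker delta

  δ : ∀ {n} → SquareMatrix n
  δ zero    zero    = 1#
  δ zero    (suc _) = 0#
  δ (suc _) zero    = 0#
  δ (suc i) (suc j) = δ i j

  δ-refl : ∀ {n} (i : Fin n) → δ i i ≡ 1#
  δ-refl zero    = ≡.refl
  δ-refl (suc i) = δ-refl i

  δ-≢ : ∀ {n} {i j : Fin n} → i ≢ j → δ i j ≡ 0#
  δ-≢ {i = zero}  {zero}  i≢j = contradiction ≡.refl i≢j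
  δ-≢ {i = zero}  {suc _} _   = ≡.refl
  δ-≢ {i = suc _} {zero}  _   = ≡.refl
  δ-≢ {i = suc _} {suc _} i≢j = δ-≢ (i≢j ∘ ≡.cong suc)

  δ-injective : ∀ {m n} (π : Fin m → Fin n) → (∀ {i j} → π i ≡ π j → i ≡ j) →
    ∀ i j → δ (π i) (π j) ≡ δ i j
  δ-injective π inj i j with i Fin.≟ j
  ... | yes ≡.refl = ≡.trans (δ-refl (π i)) (≡.sym (δ-refl i))
  ... | no i≢j     = ≡.trans (δ-≢ (i≢j ∘ inj)) (≡.sym (δ-≢ i≢j))

  ∑-*-δ : ∀ {n} (t : Vector Carrier n) i → ∑ (λ k → t k * δ k i) ≈ t i
  ∑-*-δ t i = begin
    ∑ (λ k → t k * δ k i) ≈⟨ ∑-single _ i (λ {k} k≢i → trans (*-congˡ (reflexive (δ-≢ k≢i))) (zeroʳ _)) ⟩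
    t i * δ i i             ≈⟨ *-congˡ (reflexive (δ-refl i)) ⟩
    t i * 1#                ≈⟨ *-identityʳ _ ⟩
    t i                     ∎

  ∑-δ-* : ∀ {n} (t : Vector Carrier n) i → ∑ (λ k → δ i k * t k) ≈ t i
  ∑-δ-* t i = begin
    ∑ (λ k → δ i k * t k) ≈⟨ ∑-single _ i (λ {k} k≢i → trans (*-congʳ (reflexive (δ-≢ (k≢i ∘ ≡.sym)))) (zeroˡ _)) ⟩
    δ i i * t i             ≈⟨ *-congʳ (reflexive (δ-refl i)) ⟩
    1# * t i                ≈⟨ *-identityˡ _ ⟩
    t i                     ∎

  sgn : ∀ {n} → Fin n → Carrier
  sgn j = (- 1#) ^ toℕ j

  -- Linear functionals of a row

  Linear : ∀ {n} → (Vector Carrier n → Carrier) → Set (c ⊔ ℓ)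
  Linear φ = ∀ a {u v w} → (∀ q → w q ≈ a * u q + v q) → φ w ≈ a * φ u + φ v

  module _ {n} {φ : Vector Carrier n → Carrier} (linear : Linear φ) where

    linear-+ : ∀ {u v w} → (∀ q → w q ≈ u q + v q) → φ w ≈ φ u + φ v
    linear-+ w≈ = trans (linear 1# (λ q → trans (w≈ q) (+-congʳ (sym (*-identityˡ _))))) (+-congʳ (*-identityˡ _))

    linear-zero : ∀ {u} → (∀ q → u q ≈ 0#) → φ u ≈ 0#
    linear-zero {u} u≈0 = begin
      -- Linearity is applied with `u` in all three places, as `u = (- 1#) * u + u` when `u`
      -- vanishes.
      φ u                ≈⟨ linear (- 1#) (λ q → trans (u≈0 q) (sym (-1x+x q))) ⟩
      - 1# * φ u + φ u   ≈⟨ +-congʳ (-1*x≈-x _) ⟩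
      - φ u + φ u        ≈⟨ -‿inverseˡ _ ⟩
      0#                 ∎
      where
      -1x+x : ∀ q → - 1# * u q + u q ≈ 0#
      -1x+x q = trans (+-congʳ (-1*x≈-x _)) (-‿inverseˡ _)

    linear-∑ : ∀ {k} (a : Vector Carrier k) (v : Rows k n) →
      φ (λ q → ∑ λ j → a j * v j q) ≈ ∑ λ j → a j * φ (v j)
    linear-∑ {zero}  a v = trans (linear-zero λ _ → ∑-empty _) (sym (∑-empty _))
    linear-∑ {suc k} a v = begin
      φ (λ q → ∑ λ j → a j * v j q)                                 ≈⟨ linear (a zero) (λ q → ∑-suc _) ⟩
      a zero * φ (v zero) + φ (λ q → ∑ λ j → a (suc j) * v (suc j) q) ≈⟨ +-congˡ (linear-∑ (a ∘ suc) (v ∘ suc)) ⟩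
      a zero * φ (v zero) + ∑ (λ j → a (suc j) * φ (v (suc j)))     ≈⟨ ∑-suc _ ⟨
      ∑ (λ j → a j * φ (v j))                                       ∎

  -- Alternating forms

  -- The field `linear` relates three matrices that agree off row `i`, instead of updates of one
  -- matrix. Forms obtained by bordering or multiplying the argument then inherit it without any
  -- commutation with row updates.
  record RowAlternating {m n} (f : Rows m n → Carrier) : Set (c ⊔ ℓ) where
    field
      cong     : ∀ {A B} → (∀ i → A i ≋ B i) → f A ≈ f B
      linear   : ∀ i a A B C → (∀ {k} → k ≢ i → A k ≋ B k) → (∀ {k} → k ≢ i → A k ≋ C k) →
                 (∀ q → A i q ≈ a * B i q + C i q) → f A ≈ a * f B + f C
      adjacent : ∀ {i j} → Adjacent i j → ∀ {A} → A i ≋ A j → f A ≈ 0#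

  Alternates : ∀ {m n} → (Rows m n → Carrier) → Fin m → Fin m → Set (c ⊔ ℓ)
  Alternates f i j = ∀ A → A i ≋ A j → f A ≈ 0#

  module _ {m n} (A : Rows m n) {i j : Fin m} (i≢j : i ≢ j) where

    replace : Vector Carrier n → Vector Carrier n → Rows m n
    replace u v k with k Fin.≟ i | k Fin.≟ j
    ... | yes _ | _     = u
    ... | no _  | yes _ = v
    ... | no _  | no _  = A k

    module _ (u v : Vector Carrier n) where

      replace-fst : replace u v i ≋ u
      replace-fst with i Fin.≟ i | i Fin.≟ j
      ... | yes _  | _ = λ _ → refl
      ... | no i≢i | _ = contradiction ≡.refl i≢i

      replace-snd : replace u v j ≋ v
      replace-snd with j Fin.≟ i | j Fin.≟ j
      ... | yes j≡i | _     = contradiction (≡.sym j≡i) i≢j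
      ... | no _    | yes _ = λ _ → refl
      ... | no _    | no j≢j = contradiction ≡.refl j≢j

      replace-off : ∀ {k} → k ≢ i → k ≢ j → replace u v k ≋ A k
      replace-off {k} k≢i k≢j with k Fin.≟ i | k Fin.≟ j
      ... | yes k≡i | _       = contradiction k≡i k≢i
      ... | no _    | yes k≡j = contradiction k≡j k≢j
      ... | no _    | no _    = λ _ → refl

      replace-≢fst : ∀ u′ {k} → k ≢ i → replace u v k ≋ replace u′ v k
      replace-≢fst u′ {k} k≢i with k Fin.≟ i | k Fin.≟ j
      ... | yes k≡i | _     = contradiction k≡i k≢i
      ... | no _    | yes _ = λ _ → refl
      ... | no _    | no _  = λ _ → refl

      replace-≢snd : ∀ v′ {k} → k ≢ j → replace u v k ≋ replace u v′ k
      replace-≢snd v′ {k} k≢j with k Fin.≟ i | k Fin.≟ j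
      ... | yes _ | _       = λ _ → refl
      ... | no _  | yes k≡j = contradiction k≡j k≢j
      ... | no _  | no _    = λ _ → refl

  module _ {m n} {f : Rows m n → Carrier} (f-alt : RowAlternating f) where

    open RowAlternating f-alt

    -- Polarisation: expand f (u + v, u + v) = 0.
    swap : ∀ {i j} → i ≢ j → Alternates f i j → ∀ A B →
      (∀ {k} → k ≢ i → k ≢ j → A k ≋ B k) → A i ≋ B j → A j ≋ B i → f A ≈ - f B
    swap {i} {j} i≢j alt A B A≋B Ai≋Bj Aj≋Bi = begin
      f A         ≈⟨ cong A≋M ⟩
      f (M u v)   ≈⟨ +-inverseˡ-unique _ _ uv+vu ⟩
      - f (M v u) ≈⟨ -‿cong (cong B≋M) ⟨
      - f B       ∎
      where
      M = replace A i≢j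
      u v s : Vector Carrier n
      u = A i
      v = A j
      s q = u q + v q

      A≋M : ∀ k → A k ≋ M u v k
      A≋M k with k Fin.≟ i | k Fin.≟ j
      ... | yes ≡.refl | _          = λ _ → refl
      ... | no _       | yes ≡.refl = λ _ → refl
      ... | no _       | no _       = λ _ → refl

      B≋M : ∀ k → B k ≋ M v u k
      B≋M k with k Fin.≟ i | k Fin.≟ j
      ... | yes ≡.refl | _          = sym ∘ Aj≋Bi
      ... | no _       | yes ≡.refl = sym ∘ Ai≋Bj
      ... | no k≢i     | no k≢j     = sym ∘ A≋B k≢i k≢j

      lin-fst : ∀ w → Linear (λ z → f (M z w))
      lin-fst w a {x} {y} {z} z≈ = linear i a _ _ _
        (replace-≢fst A i≢j z w x) (replace-≢fst A i≢j z w y)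
        (λ q → trans (replace-fst A i≢j z w q) (trans (z≈ q)
          (sym (+-cong (*-congˡ (replace-fst A i≢j x w q)) (replace-fst A i≢j y w q)))))

      lin-snd : ∀ w → Linear (λ z → f (M w z))
      lin-snd w a {x} {y} {z} z≈ = linear j a _ _ _
        (replace-≢snd A i≢j w z x) (replace-≢snd A i≢j w z y)
        (λ q → trans (replace-snd A i≢j w z q) (trans (z≈ q)
          (sym (+-cong (*-congˡ (replace-snd A i≢j w x q)) (replace-snd A i≢j w y q)))))

      diag : ∀ w → f (M w w) ≈ 0#
      diag w = alt _ λ q → trans (replace-fst A i≢j w w q) (sym (replace-snd A i≢j w w q))

      uv+vu : f (M u v) + f (M v u) ≈ 0#
      uv+vu = begin
        f (M u v) + f (M v u)                             ≈⟨ +-cong (+-identityˡ _) (+-identityʳ _) ⟨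
        (0# + f (M u v)) + (f (M v u) + 0#)               ≈⟨ +-cong (+-congʳ (diag u)) (+-congˡ (diag v)) ⟨
        (f (M u u) + f (M u v)) + (f (M v u) + f (M v v)) ≈⟨ +-cong (linear-+ (lin-snd u) (λ _ → refl)) (linear-+ (lin-snd v) (λ _ → refl)) ⟨
        f (M u s) + f (M v s)                             ≈⟨ linear-+ (lin-fst s) (λ _ → refl) ⟨
        f (M s s)                                         ≈⟨ diag s ⟩
        0#                                                ∎

    -- Exchanging the adjacent rows `j` and `k` costs only a sign and turns equality of rows `i` and
    -- `k` into equality of rows `i` and `j`.
    alternates-adjacent : ∀ {i j k} → i ≢ j → i ≢ k → Adjacent j k →
      Alternates f i j → Alternates f i k
    alternates-adjacent {i} {j} {k} i≢j i≢k a alt A Ai≋Ak = begin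
      f A    ≈⟨ swap j≢k (λ _ → adjacent a) A A′ (λ p q → sym ∘ replace-off A j≢k _ _ p q)
                  (sym ∘ replace-snd A j≢k _ _) (sym ∘ replace-fst A j≢k _ _) ⟩
      - f A′ ≈⟨ -‿cong (alt A′ λ q → trans (replace-off A j≢k _ _ i≢j i≢k q)
                  (trans (Ai≋Ak q) (sym (replace-fst A j≢k _ _ q)))) ⟩
      - 0#   ≈⟨ -0#≈0# ⟩
      0#     ∎
      where
      j≢k = adjacent⇒≢ a
      A′ = replace A j≢k (A k) (A j)

  -- Pairs containing the first row suffice below: the first row is the one subtracted from the
  -- others, and the one exchanged when the identity is rotated. The second row of the pair is moved
  -- down one place at a time.
  alternates-zero : ∀ {m n} {f : Rows (suc m) n → Carrier} → RowAlternating f →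
    ∀ i → Alternates f zero (suc i)
  alternates-zero {suc m} {f = f} f-alt = <-weakInduction (λ i → Alternates f zero (suc i))
    (λ A → RowAlternating.adjacent f-alt here)
    (λ i → alternates-adjacent f-alt (λ ()) (λ ()) (there (adjacent-inject₁-suc i)))

  module _ {m n} {f : Rows (suc m) n → Carrier} (f-alt : RowAlternating f) (e : Vector Carrier n) where

    open RowAlternating f-alt

    -- By linearity in row `i`, the two values differ by `a` times the value at a matrix that has
    -- `e` both as its first row and in place of row `i`.
    add-first-row : ∀ i a {S T} → (∀ {k} → k ≢ i → S k ≋ T k) →
      (∀ q → S i q ≈ a * e q + T i q) → f (e ∷ S) ≈ f (e ∷ T)
    add-first-row i a {S} {T} S≋T Si≈ = begin
      f (e ∷ S)                  ≈⟨ linear (suc i) a (e ∷ S) (e ∷ S′) (e ∷ T) S≋S′ S≋T′ Si≈S′i ⟩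
      a * f (e ∷ S′) + f (e ∷ T) ≈⟨ +-congʳ (*-congˡ (alternates-zero f-alt i (e ∷ S′) (sym ∘ S′i≋e))) ⟩
      a * 0# + f (e ∷ T)         ≈⟨ trans (+-congʳ (zeroʳ a)) (+-identityˡ _) ⟩
      f (e ∷ T)                  ∎
      where
      S′ : Rows m n
      S′ = updateAt S i (const e)

      S′i≋e : S′ i ≋ e
      S′i≋e q = reflexive (≡.cong (λ v → v q) (updateAt-updates i S))

      S≋S′ : ∀ {k} → k ≢ suc i → (e ∷ S) k ≋ (e ∷ S′) k
      S≋S′ {zero}  _    q = refl
      S≋S′ {suc k} k≢i q = reflexive (≡.cong (λ v → v q) (≡.sym (updateAt-minimal k i S (k≢i ∘ ≡.cong suc))))

      S≋T′ : ∀ {k} → k ≢ suc i → (e ∷ S) k ≋ (e ∷ T) k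
      S≋T′ {zero}  _    q = refl
      S≋T′ {suc k} k≢i = S≋T (k≢i ∘ ≡.cong suc)

      Si≈S′i : ∀ q → S i q ≈ a * S′ i q + T i q
      Si≈S′i q = trans (Si≈ q) (+-congʳ (*-congˡ (sym (S′i≋e q))))

    add-first-row-everywhere : ∀ (a : Vector Carrier m) {S T} →
      (∀ k q → S k q ≈ a k * e q + T k q) → f (e ∷ S) ≈ f (e ∷ T)
    add-first-row-everywhere a S≈ = go (λ T → f (e ∷ T))
      (λ S≋T → cong λ { zero _ → refl ; (suc k) → S≋T k }) add-first-row a S≈
      where
      -- The rows are changed one at a time. Abstracting the form to any `g` that admits single-row
      -- changes lets the induction freeze the leading row and recurse on the rest.
      go : ∀ {m} (g : Rows m n → Carrier) → (∀ {S T} → (∀ k → S k ≋ T k) → g S ≈ g T) →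
        (∀ i a {S T} → (∀ {k} → k ≢ i → S k ≋ T k) → (∀ q → S i q ≈ a * e q + T i q) → g S ≈ g T) →
        ∀ (a : Vector Carrier m) {S T} → (∀ k q → S k q ≈ a k * e q + T k q) → g S ≈ g T
      go {zero}  g g-cong g-step a S≈ = g-cong λ ()
      go {suc m} g g-cong g-step a {S} {T} S≈ = begin
        g S                    ≈⟨ g-cong (λ { zero _ → refl ; (suc k) _ → refl }) ⟩
        g (S zero ∷ S ∘ suc)   ≈⟨ go (λ T′ → g (S zero ∷ T′))
                                    (λ S≋T → g-cong λ { zero _ → refl ; (suc k) → S≋T k })
                                    (λ i a S≋T Si≈ → g-step (suc i) a
                                      (λ { {zero} _ _ → refl ; {suc k} k≢i → S≋T (k≢i ∘ ≡.cong suc) }) Si≈)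
                                    (a ∘ suc) (S≈ ∘ suc) ⟩
        g (S zero ∷ T ∘ suc)   ≈⟨ g-step zero (a zero)
                                    (λ { {zero} k≢0 → contradiction ≡.refl k≢0 ; {suc k} _ _ → refl })
                                    (S≈ zero) ⟩
        g T                    ∎

  -- Bordered matrices and expansion along the first row

  insertZero : ∀ {m n} → Fin (suc n) → Rows m n → Rows m (suc n)
  insertZero j M k = insertAt (M k) j 0#

  insertZero-at : ∀ {m n} j (M : Rows m n) k → insertZero j M k j ≡ 0#
  insertZero-at j M k = insertAt-lookup (M k) j 0#

  insertZero-off : ∀ {m n} j (M : Rows m n) k q → insertZero j M k (punchIn j q) ≡ M k q
  insertZero-off j M k = insertAt-punchIn (M k) j 0#

  border : ∀ {m n} → Fin (suc n) → Rows m n → Rows (suc m) (suc n)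
  border j M = δ j ∷ insertZero j M

  module _ {m n} {f : Rows (suc m) (suc n) → Carrier} (f-alt : RowAlternating f) where

    open RowAlternating f-alt

    -- This produces an alternating form one size smaller, to which the induction in
    -- `alternating-unique` applies.
    border-alternating : ∀ j → RowAlternating (λ M → f (border j M))
    border-alternating j = record
      { cong     = λ M≋ → cong λ { zero _ → refl ; (suc k) → insert-cong (M≋ k) }
      ; linear   = λ i a A B C A≋B A≋C Ai≈ → linear (suc i) a (border j A) (border j B) (border j C)
          (λ { {zero} _ _ → refl ; {suc k} k≢i → insert-cong (A≋B (k≢i ∘ ≡.cong suc)) })
          (λ { {zero} _ _ → refl ; {suc k} k≢i → insert-cong (A≋C (k≢i ∘ ≡.cong suc)) })
          (insert-linear Ai≈)
      ; adjacent = λ a Ai≋Aj → adjacent (there a) (insert-cong Ai≋Aj)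
      }
      where
      insert-linear : ∀ {a} {u v w : Vector Carrier n} → (∀ q → w q ≈ a * u q + v q) →
        ∀ q → insertAt w j 0# q ≈ a * insertAt u j 0# q + insertAt v j 0# q
      insert-linear {a} {u} {v} {w} w≈ q with punchView j q
      ... | at rewrite insertAt-lookup u j 0# | insertAt-lookup v j 0# | insertAt-lookup w j 0# =
        sym (trans (+-identityʳ _) (zeroʳ a))
      ... | off p rewrite insertAt-punchIn u j 0# p | insertAt-punchIn v j 0# p | insertAt-punchIn w j 0# p = w≈ p

      insert-cong : ∀ {u v} → u ≋ v → insertAt u j 0# ≋ insertAt v j 0#
      insert-cong {u} {v} u≋v q with punchView j q
      ... | at rewrite insertAt-lookup u j 0# | insertAt-lookup v j 0# = refl
      ... | off p rewrite insertAt-punchIn u j 0# p | insertAt-punchIn v j 0# p = u≋v p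

    -- The first row is the combination of the unit rows `δ j` with coefficients `A zero j`. Once it
    -- is `δ j`, subtracting its multiples from the other rows clears column `j` and leaves the
    -- bordered minor.
    expand-first-row : ∀ A → f A ≈ ∑ λ j → A zero j * f (border j (λ k q → A (suc k) (punchIn j q)))
    expand-first-row A = begin
      f A                                                     ≈⟨ cong (λ { zero q → sym (∑-*-δ (A zero) q) ; (suc k) _ → refl }) ⟩
      f ((λ q → ∑ λ j → A zero j * δ j q) ∷ A ∘ suc)        ≈⟨ linear-∑ first-linear (A zero) δ ⟩
      ∑ (λ j → A zero j * f (δ j ∷ A ∘ suc))                ≈⟨ ∑-cong (λ j → *-congˡ (clear j)) ⟩
      ∑ (λ j → A zero j * f (border j (λ k q → A (suc k) (punchIn j q)))) ∎
      where
      first-linear : Linear (λ u → f (u ∷ A ∘ suc))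
      first-linear a {u} {v} {w} = linear zero a (w ∷ A ∘ suc) (u ∷ A ∘ suc) (v ∷ A ∘ suc)
        (λ { {zero} k≢0 → contradiction ≡.refl k≢0 ; {suc k} _ _ → refl })
        (λ { {zero} k≢0 → contradiction ≡.refl k≢0 ; {suc k} _ _ → refl })

      clear : ∀ j → f (δ j ∷ A ∘ suc) ≈ f (border j (λ k q → A (suc k) (punchIn j q)))
      clear j = add-first-row-everywhere f-alt (δ j) (λ k → A (suc k) j) eq
        where
        M : Rows m n
        M k q = A (suc k) (punchIn j q)
        eq : ∀ k q → A (suc k) q ≈ A (suc k) j * δ j q + insertZero j M k q
        eq k q with punchView j q
        ... | at rewrite insertZero-at j M k | δ-refl j = sym (trans (+-identityʳ _) (*-identityʳ _))
        ... | off p rewrite insertZero-off j M k p | δ-≢ (Fin.punchInᵢ≢i j p ∘ ≡.sym) =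
          sym (trans (+-congʳ (zeroʳ _)) (+-identityˡ _))

  module _ {n} {f : Rows (suc n) (suc n) → Carrier} (f-alt : RowAlternating f) where

    open RowAlternating f-alt

    -- Bordering the identity is the identity with row `j` moved to the top. Passing from
    -- `inject₁ j` to `suc j` exchanges the first row with row `suc j`, so each step contributes one
    -- factor `- 1#`.
    border-δ : ∀ j → f (border j δ) ≈ sgn j * f δ
    border-δ j = trans (cong border≋) (rotation j)
      where
      rotated : Fin (suc n) → Rows (suc n) (suc n)
      rotated j = δ j ∷ λ k → δ (punchIn j k)

      border≋ : ∀ k → border j δ k ≋ rotated j k
      border≋ zero    q = refl
      border≋ (suc k) q with punchView j q
      ... | at rewrite insertZero-at j δ k | δ-≢ (Fin.punchInᵢ≢i j k) = refl
      ... | off p rewrite insertZero-off j δ k p =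
        reflexive (≡.sym (δ-injective (punchIn j) (Fin.punchIn-injective j _ _) k p))

      rotation : ∀ j → f (rotated j) ≈ sgn j * f δ
      rotation = <-weakInduction _ base step
        where
        base : f (rotated zero) ≈ 1# * f δ
        base = trans (cong λ { zero _ → refl ; (suc k) _ → refl }) (sym (*-identityˡ _))

        off-swap : ∀ {n} (j : Fin n) {k} → k ≢ j → punchIn (suc j) k ≡ punchIn (inject₁ j) k
        off-swap zero    {zero}  k≢j = contradiction ≡.refl k≢j
        off-swap zero    {suc k} k≢j = ≡.refl
        off-swap (suc j) {zero}  k≢j = ≡.refl
        off-swap (suc j) {suc k} k≢j = ≡.cong suc (off-swap j (k≢j ∘ ≡.cong suc))

        punchIn-suc : ∀ {n} (j : Fin n) → punchIn (suc j) j ≡ inject₁ j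
        punchIn-suc zero    = ≡.refl
        punchIn-suc (suc j) = ≡.cong suc (punchIn-suc j)

        punchIn-inject₁ : ∀ {n} (j : Fin n) → punchIn (inject₁ j) j ≡ suc j
        punchIn-inject₁ zero    = ≡.refl
        punchIn-inject₁ (suc j) = ≡.cong suc (punchIn-inject₁ j)

        step : ∀ j → f (rotated (inject₁ j)) ≈ sgn (inject₁ j) * f δ → f (rotated (suc j)) ≈ sgn (suc j) * f δ
        step j ih = begin
          f (rotated (suc j))           ≈⟨ swap f-alt {zero} {suc j} (λ ()) (alternates-zero f-alt j)
                                             (rotated (suc j)) (rotated (inject₁ j))
                                             (λ { {zero} k≢0 _ → contradiction ≡.refl k≢0
                                                ; {suc k} _ k≢j q → reflexive (≡.cong (λ i → δ i q) (off-swap j (k≢j ∘ ≡.cong suc))) })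
                                             (λ q → reflexive (≡.cong (λ i → δ i q) (≡.sym (punchIn-inject₁ j))))
                                             (λ q → reflexive (≡.cong (λ i → δ i q) (punchIn-suc j))) ⟩
          - f (rotated (inject₁ j))     ≈⟨ -‿cong ih ⟩
          - (sgn (inject₁ j) * f δ)     ≈⟨ -1*x≈-x _ ⟨
          - 1# * (sgn (inject₁ j) * f δ) ≈⟨ *-assoc _ _ _ ⟨
          (- 1# * sgn (inject₁ j)) * f δ ≡⟨ ≡.cong (λ k → (- 1# * (- 1#) ^ k) * f δ) (Fin.toℕ-inject₁ j) ⟩
          sgn (suc j) * f δ             ∎

  -- The induction hypothesis is applied to the bordered form at each minor, and its value at the
  -- identity supplies the cofactor sign. The resulting sum is the defining expansion of `det`, so
  -- alternation of `det` itself is not presupposed.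
  alternating-unique : ∀ {n} {f : Rows n n → Carrier} → RowAlternating f → ∀ A → f A ≈ f δ * det A
  alternating-unique {zero} f-alt A = trans (RowAlternating.cong f-alt λ ()) (sym (*-identityʳ _))
  alternating-unique {suc n} {f} f-alt A = begin
    f A                                                       ≈⟨ expand-first-row f-alt A ⟩
    ∑ (λ j → A zero j * f (border j (minor₀ A j)))          ≈⟨ ∑-cong (λ j → *-congˡ (alternating-unique (border-alternating f-alt j) (minor₀ A j))) ⟩
    ∑ (λ j → A zero j * (f (border j δ) * det (minor₀ A j))) ≈⟨ ∑-cong (λ j → *-congˡ (*-congʳ (border-δ f-alt j))) ⟩
    ∑ (λ j → A zero j * ((sgn j * f δ) * det (minor₀ A j))) ≈⟨ ∑-cong (λ j → rearrange (A zero j) (sgn j) (f δ) (det (minor₀ A j))) ⟩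
    ∑ (λ j → f δ * (sgn j * (A zero j * det (minor₀ A j)))) ≈⟨ *-∑ (f δ) _ ⟨
    f δ * ∑ (λ j → sgn j * (A zero j * det (minor₀ A j)))     ≈⟨ *-congˡ (det-expand A) ⟨
    f δ * det A                                               ∎
    where
    rearrange : ∀ a s x d → a * ((s * x) * d) ≈ x * (s * (a * d))
    rearrange = solve 4 (λ a s x d → a :* ((s :* x) :* d) := x :* (s :* (a :* d))) refl

  -- Determinants

  det-cong : ∀ {n} {A B : SquareMatrix n} → (∀ p → A p ≋ B p) → det A ≈ det B
  det-cong {zero} A≋B = refl
  det-cong {suc n} {A} {B} A≋B = begin
    det A                                             ≈⟨ det-expand A ⟩
    ∑ (λ j → sgn j * (A zero j * det (minor₀ A j)))   ≈⟨ ∑-cong (λ j → *-congˡ (*-cong (A≋B zero j)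
                                                           (det-cong λ p q → A≋B (suc p) (punchIn j q)))) ⟩
    ∑ (λ j → sgn j * (B zero j * det (minor₀ B j)))   ≈⟨ det-expand B ⟨
    det B                                             ∎

  det-single-entry : ∀ {n} (A : SquareMatrix (suc n)) j → (∀ {k} → k ≢ j → A zero k ≈ 0#) →
    det A ≈ sgn j * (A zero j * det (minor₀ A j))
  det-single-entry A j A₀≈0 = trans (det-expand A)
    (∑-single _ j λ k≢j → trans (*-congˡ (trans (*-congʳ (A₀≈0 k≢j)) (zeroˡ _))) (zeroʳ _))

  det-δ : ∀ n → det (δ {n}) ≈ 1#
  det-δ zero    = refl
  det-δ (suc n) = begin
    det (δ {suc n})          ≈⟨ det-single-entry {n} δ zero (λ { {zero} 0≢0 → contradiction ≡.refl 0≢0 ; {suc k} _ → refl }) ⟩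
    1# * (1# * det (δ {n}))  ≈⟨ trans (*-identityˡ _) (*-identityˡ _) ⟩
    det (δ {n})              ≈⟨ det-δ n ⟩
    1#                       ∎

  δ-sym : ∀ {n} (i j : Fin n) → δ i j ≡ δ j i
  δ-sym zero    zero    = ≡.refl
  δ-sym zero    (suc j) = ≡.refl
  δ-sym (suc i) zero    = ≡.refl
  δ-sym (suc i) (suc j) = δ-sym i j

  -- Row alternation is proved for the transpose first: cofactor expansion along the first row
  -- interacts with the columns one at a time.
  strike : ∀ {n} → SquareMatrix (suc n) → Fin (suc n) → SquareMatrix n
  strike A j p q = A (punchIn j p) (suc q)

  detᵀ : ∀ {n} → SquareMatrix n → Carrier
  detᵀ A = det (flip A)

  detᵀ-expand : ∀ {n} (A : SquareMatrix (suc n)) →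
    detᵀ A ≈ ∑ λ j → sgn j * (A j zero * detᵀ (strike A j))
  detᵀ-expand A = det-expand (flip A)

  detᵀ-cong : ∀ {n} {A B : SquareMatrix n} → (∀ p → A p ≋ B p) → detᵀ A ≈ detᵀ B
  detᵀ-cong A≋B = det-cong λ p q → A≋B q p

  -- Each term of the expansion involves row `i` exactly once: through its leading entry if row `i`
  -- is struck out, and through the minor otherwise.
  detᵀ-linear : ∀ {n} i a (A B C : SquareMatrix n) →
    (∀ {k} → k ≢ i → A k ≋ B k) → (∀ {k} → k ≢ i → A k ≋ C k) →
    (∀ q → A i q ≈ a * B i q + C i q) → detᵀ A ≈ a * detᵀ B + detᵀ C
  detᵀ-linear {suc n} i a A B C A≋B A≋C Ai≈ = begin
    detᵀ A                                     ≈⟨ detᵀ-expand A ⟩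
    ∑ (term A)                                 ≈⟨ ∑-cong term-linear ⟩
    ∑ (λ j → a * term B j + term C j)          ≈⟨ ∑-+ _ _ ⟩
    ∑ (λ j → a * term B j) + ∑ (term C)        ≈⟨ +-congʳ (*-∑ a _) ⟨
    a * ∑ (term B) + ∑ (term C)                ≈⟨ +-cong (*-congˡ (detᵀ-expand B)) (detᵀ-expand C) ⟨
    a * detᵀ B + detᵀ C                        ∎
    where
    term : SquareMatrix (suc n) → Vector Carrier (suc n)
    term A j = sgn j * (A j zero * detᵀ (strike A j))

    term-linear : ∀ j → term A j ≈ a * term B j + term C j
    term-linear j with punchView j i
    ... | at = begin
      sgn i * (A i zero * detᵀ (strike A i))                        ≈⟨ *-congˡ (*-congʳ (Ai≈ zero)) ⟩
      sgn i * ((a * B i zero + C i zero) * detᵀ (strike A i))       ≈⟨ lemma _ a _ _ _ ⟩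
      a * (sgn i * (B i zero * detᵀ (strike A i))) + sgn i * (C i zero * detᵀ (strike A i))
        ≈⟨ +-cong (*-congˡ (*-congˡ (*-congˡ (detᵀ-cong λ p q → A≋B (Fin.punchInᵢ≢i i p) (suc q)))))
                  (*-congˡ (*-congˡ (detᵀ-cong λ p q → A≋C (Fin.punchInᵢ≢i i p) (suc q)))) ⟩
      a * term B i + term C i                                       ∎
      where
      lemma : ∀ s a b c d → s * ((a * b + c) * d) ≈ a * (s * (b * d)) + s * (c * d)
      lemma = solve 5 (λ s a b c d → s :* ((a :* b :+ c) :* d) := a :* (s :* (b :* d)) :+ s :* (c :* d)) refl
    ... | off i′ = begin
      sgn j * (A j zero * detᵀ (strike A j))
        ≈⟨ *-congˡ (*-congˡ (detᵀ-linear i′ a (strike A j) (strike B j) (strike C j)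
             (λ k≢i′ q → A≋B (k≢i′ ∘ Fin.punchIn-injective j _ _) (suc q))
             (λ k≢i′ q → A≋C (k≢i′ ∘ Fin.punchIn-injective j _ _) (suc q))
             (Ai≈ ∘ suc))) ⟩
      sgn j * (A j zero * (a * detᵀ (strike B j) + detᵀ (strike C j)))
        ≈⟨ lemma _ a _ _ _ ⟩
      a * (sgn j * (A j zero * detᵀ (strike B j))) + sgn j * (A j zero * detᵀ (strike C j))
        ≈⟨ +-cong (*-congˡ (*-congˡ (*-congʳ (A≋B j≢i zero)))) (*-congˡ (*-congʳ (A≋C j≢i zero))) ⟩
      a * term B j + term C j ∎
      where
      j≢i : j ≢ punchIn j i′
      j≢i = Fin.punchInᵢ≢i j i′ ∘ ≡.sym
      lemma : ∀ s a b c d → s * (b * (a * c + d)) ≈ a * (s * (b * c)) + s * (b * d)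
      lemma = solve 5 (λ s a b c d → s :* (b :* (a :* c :+ d)) := a :* (s :* (b :* c)) :+ s :* (b :* d)) refl

  -- The two deletions differ in a single place, which holds row `j` in one and row `i` in the
  -- other.
  adjacent-punchIn : ∀ {m n} {i j : Fin (suc m)} → Adjacent i j → ∀ {A : Rows (suc m) n} → A i ≋ A j →
    ∀ k → A (punchIn i k) ≋ A (punchIn j k)
  adjacent-punchIn here Ai≋Aj zero    = sym ∘ Ai≋Aj
  adjacent-punchIn here Ai≋Aj (suc k) = λ _ → refl
  adjacent-punchIn (there a) Ai≋Aj zero = λ _ → refl
  adjacent-punchIn {suc m} (there a) {A} Ai≋Aj (suc k) = adjacent-punchIn a {A ∘ suc} Ai≋Aj k

  sgn-adjacent : ∀ {n} {i j : Fin n} → Adjacent i j → sgn j ≈ - 1# * sgn i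
  sgn-adjacent here      = refl
  sgn-adjacent (there a) = *-congˡ (sgn-adjacent a)

  -- Striking any third row leaves the equal adjacent pair in the minor, which vanishes by
  -- induction. The two remaining terms have equal entries, equal minors and opposite signs.
  detᵀ-adjacent : ∀ {n} {i j : Fin n} → Adjacent i j → ∀ {A : SquareMatrix n} → A i ≋ A j → detᵀ A ≈ 0#
  detᵀ-adjacent {suc n} {i} {j} a {A} Ai≋Aj = begin
    detᵀ A                                     ≈⟨ detᵀ-expand A ⟩
    ∑ term                                     ≈⟨ ∑-adjacent term a other ⟩
    term i + term j                            ≈⟨ +-congˡ (*-cong (sgn-adjacent a) (*-cong (sym (Ai≋Aj zero))
                                                    (sym (detᵀ-cong λ p q → adjacent-punchIn a {A} Ai≋Aj p (suc q))))) ⟩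
    term i + (- 1# * sgn i) * (A i zero * detᵀ (strike A i)) ≈⟨ +-congˡ (trans (*-assoc _ _ _) (-1*x≈-x _)) ⟩
    term i + - term i                          ≈⟨ -‿inverseʳ _ ⟩
    0#                                         ∎
    where
    term : Vector Carrier (suc n)
    term j = sgn j * (A j zero * detᵀ (strike A j))

    other : ∀ {k} → k ≢ i → k ≢ j → term k ≈ 0#
    other {k} k≢i k≢j with i′ , j′ , a′ , ≡.refl , ≡.refl ← adjacent-punchOut a k≢i k≢j =
      trans (*-congˡ (trans (*-congˡ (detᵀ-adjacent a′ {strike A k} (Ai≋Aj ∘ suc))) (zeroʳ _))) (zeroʳ _)

  detᵀ-alternating : ∀ {n} → RowAlternating (detᵀ {n})
  detᵀ-alternating = record { cong = detᵀ-cong ; linear = detᵀ-linear ; adjacent = detᵀ-adjacent }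

  -- An instance of uniqueness, since `detᵀ` alternates and takes the value 1 at the identity. It
  -- transfers to `det` the row properties proved for `detᵀ`.
  det-transpose : ∀ {n} (A : SquareMatrix n) → det (flip A) ≈ det A
  det-transpose {n} A = begin
    detᵀ A             ≈⟨ alternating-unique detᵀ-alternating A ⟩
    detᵀ {n} δ * det A ≈⟨ *-congʳ (trans (det-cong {n} {flip δ} {δ} λ p q → reflexive (δ-sym q p)) (det-δ n)) ⟩
    1# * det A         ≈⟨ *-identityˡ _ ⟩
    det A              ∎

  -- Multiplicativity and simultaneous permutation of rows and columns

  infixl 7 _⊡_
  _⊡_ : ∀ {n} → SquareMatrix n → SquareMatrix n → SquareMatrix n
  (A ⊡ B) p q = ∑ λ k → A p k * B k q

  det-⊡-alternating : ∀ {n} (B : SquareMatrix n) → RowAlternating (λ A → det (A ⊡ B))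
  det-⊡-alternating B = record
    { cong     = λ A≋C → det-cong λ p → row-cong (A≋C p)
    ; linear   = λ i a A C E A≋C A≋E Ai≈ → begin
        det (A ⊡ B)                       ≈⟨ det-transpose (A ⊡ B) ⟨
        detᵀ (A ⊡ B)                      ≈⟨ detᵀ-linear i a (A ⊡ B) (C ⊡ B) (E ⊡ B)
                                               (row-cong ∘ A≋C) (row-cong ∘ A≋E) (row-linear Ai≈) ⟩
        a * detᵀ (C ⊡ B) + detᵀ (E ⊡ B)   ≈⟨ +-cong (*-congˡ (det-transpose (C ⊡ B))) (det-transpose (E ⊡ B)) ⟩
        a * det (C ⊡ B) + det (E ⊡ B)     ∎
    ; adjacent = λ a {A} Ai≋Aj → trans (sym (det-transpose (A ⊡ B)))
        (detᵀ-adjacent a {A ⊡ B} (row-cong Ai≋Aj))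
    }
    where
    row-cong : ∀ {u v : Vector Carrier _} → u ≋ v → (λ q → ∑ λ k → u k * B k q) ≋ (λ q → ∑ λ k → v k * B k q)
    row-cong u≋v q = ∑-cong λ k → *-congʳ (u≋v k)

    row-linear : ∀ {a} {u v w : Vector Carrier _} → (∀ k → w k ≈ a * u k + v k) →
      ∀ q → ∑ (λ k → w k * B k q) ≈ a * ∑ (λ k → u k * B k q) + ∑ (λ k → v k * B k q)
    row-linear {a} {u} {v} {w} w≈ q = begin
      ∑ (λ k → w k * B k q)                                   ≈⟨ ∑-cong (λ k → *-congʳ (w≈ k)) ⟩
      ∑ (λ k → (a * u k + v k) * B k q)                       ≈⟨ ∑-cong (λ k → trans (distribʳ _ _ _) (+-congʳ (*-assoc _ _ _))) ⟩
      ∑ (λ k → a * (u k * B k q) + v k * B k q)               ≈⟨ ∑-+ _ _ ⟩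
      ∑ (λ k → a * (u k * B k q)) + ∑ (λ k → v k * B k q)     ≈⟨ +-congʳ (*-∑ a _) ⟨
      a * ∑ (λ k → u k * B k q) + ∑ (λ k → v k * B k q)       ∎

  det-⊡ : ∀ {n} (A B : SquareMatrix n) → det (A ⊡ B) ≈ det A * det B
  det-⊡ A B = begin
    det (A ⊡ B)            ≈⟨ alternating-unique (det-⊡-alternating B) A ⟩
    det (δ ⊡ B) * det A    ≈⟨ *-congʳ (det-cong λ p q → ∑-δ-* (λ k → B k q) p) ⟩
    det B * det A          ≈⟨ *-comm _ _ ⟩
    det A * det B          ∎

  -- With `P` the matrix of `π`, the reindexed matrix is `P A Pᵀ`, and `P Pᵀ` is the identity. The
  -- equality `m ≡ n` is a separate argument because the intended sizes, `N * m` and `m * N`, are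
  -- only propositionally equal.
  det-reindex : ∀ {m n} → m ≡ n → (π : Fin m → Fin n) → (∀ {i j} → π i ≡ π j → i ≡ j) →
    ∀ A → det (λ p q → A (π p) (π q)) ≈ det A
  det-reindex {n = n} ≡.refl π π-injective A = begin
    det (λ p q → A (π p) (π q))          ≈⟨ det-cong PAPᵀ ⟨
    det (P ⊡ (A ⊡ flip P))               ≈⟨ trans (det-⊡ P _) (*-congˡ (det-⊡ A (flip P))) ⟩
    det P * (det A * det (flip P))       ≈⟨ solve 3 (λ p a q → p :* (a :* q) := (p :* q) :* a) refl _ _ _ ⟩
    (det P * det (flip P)) * det A       ≈⟨ *-congʳ (det-⊡ P (flip P)) ⟨
    det (P ⊡ flip P) * det A             ≈⟨ *-congʳ (trans (det-cong {n} {P ⊡ flip P} {δ} PPᵀ) (det-δ n)) ⟩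
    1# * det A                           ≈⟨ *-identityˡ _ ⟩
    det A                                ∎
    where
    P : SquareMatrix n
    P p = δ (π p)

    PAPᵀ : ∀ p q → (P ⊡ (A ⊡ flip P)) p q ≈ A (π p) (π q)
    PAPᵀ p q = begin
      ∑ (λ k → δ (π p) k * ∑ (λ l → A k l * δ (π q) l))   ≈⟨ ∑-δ-* _ (π p) ⟩
      ∑ (λ l → A (π p) l * δ (π q) l)                     ≈⟨ ∑-cong (λ l → *-congˡ (reflexive (δ-sym (π q) l))) ⟩
      ∑ (λ l → A (π p) l * δ l (π q))                     ≈⟨ ∑-*-δ _ (π q) ⟩
      A (π p) (π q)                                       ∎

    PPᵀ : ∀ p q → (P ⊡ flip P) p q ≈ δ p q
    PPᵀ p q = begin
      ∑ (λ k → δ (π p) k * δ (π q) k)    ≈⟨ ∑-δ-* (δ (π q)) (π p) ⟩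
      δ (π q) (π p)                      ≡⟨ δ-injective π π-injective q p ⟩
      δ q p                              ≡⟨ δ-sym q p ⟩
      δ p q                              ∎

  -- Block matrices

  ∑-splitAt : ∀ m {n} (t : Vector Carrier (m ℕ.+ n)) →
    ∑ t ≈ ∑ (λ i → t (i ↑ˡ n)) + ∑ (λ j → t (m ↑ʳ j))
  ∑-splitAt zero    t = sym (trans (+-congʳ (∑-empty _)) (+-identityˡ _))
  ∑-splitAt (suc m) {n} t = begin
    ∑ t                                                          ≈⟨ ∑-suc t ⟩
    t zero + ∑ (t ∘ suc)                                         ≈⟨ +-congˡ (∑-splitAt m (t ∘ suc)) ⟩
    t zero + (∑ (λ i → t (suc i ↑ˡ n)) + ∑ (λ j → t (suc m ↑ʳ j))) ≈⟨ +-assoc _ _ _ ⟨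
    (t zero + ∑ (λ i → t (suc i ↑ˡ n))) + ∑ (λ j → t (suc m ↑ʳ j)) ≈⟨ +-congʳ (∑-suc _) ⟨
    ∑ (λ i → t (i ↑ˡ n)) + ∑ (λ j → t (suc m ↑ʳ j))              ∎

  module _ {m n} (A : SquareMatrix m) (C : SquareMatrix n) where

    diagonalEntry : Fin m ⊎ Fin n → Fin m ⊎ Fin n → Carrier
    diagonalEntry (inj₁ p) (inj₁ q) = A p q
    diagonalEntry (inj₁ _) (inj₂ _) = 0#
    diagonalEntry (inj₂ _) (inj₁ _) = 0#
    diagonalEntry (inj₂ p) (inj₂ q) = C p q

    infixr 6 _⊕_
    _⊕_ : SquareMatrix (m ℕ.+ n)
    _⊕_ p q = diagonalEntry (splitAt m p) (splitAt m q)

  splitAt-punchIn : ∀ {m} n (j : Fin (suc m)) q →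
    splitAt (suc m) (punchIn (j ↑ˡ n) q) ≡ Sum.map₁ (punchIn j) (splitAt m q)
  splitAt-punchIn n zero q = ≡.refl
  splitAt-punchIn {suc m} n (suc j) zero = ≡.refl
  splitAt-punchIn {suc m} n (suc j) (suc q)
    rewrite splitAt-punchIn n j q with splitAt m q
  ... | inj₁ _ = ≡.refl
  ... | inj₂ _ = ≡.refl

  -- The first row vanishes on the columns of `C`. Deleting it together with a column of `A` gives
  -- the direct sum of a minor of `A` with `C`.
  det-⊕ : ∀ {m n} (A : SquareMatrix m) (C : SquareMatrix n) → det (A ⊕ C) ≈ det A * det C
  det-⊕ {zero} A C = sym (*-identityˡ _)
  det-⊕ {suc m} {n} A C = begin
    det (A ⊕ C)                                                     ≈⟨ det-expand (A ⊕ C) ⟩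
    ∑ term                                                          ≈⟨ ∑-splitAt (suc m) term ⟩
    ∑ (λ j → term (j ↑ˡ n)) + ∑ (λ j → term (suc m ↑ʳ j))           ≈⟨ +-cong (∑-cong left) (∑-zero right) ⟩
    ∑ (λ j → (sgn j * (A zero j * det (minor₀ A j))) * det C) + 0#  ≈⟨ +-identityʳ _ ⟩
    ∑ (λ j → (sgn j * (A zero j * det (minor₀ A j))) * det C)       ≈⟨ ∑-* (det C) _ ⟨
    ∑ (λ j → sgn j * (A zero j * det (minor₀ A j))) * det C         ≈⟨ *-congʳ (det-expand A) ⟨
    det A * det C                                                   ∎
    where
    term : Vector Carrier (suc m ℕ.+ n)
    term j = sgn j * ((A ⊕ C) zero j * det (minor₀ (A ⊕ C) j))

    minor-⊕ : ∀ j u v → diagonalEntry A C (Sum.map₁ suc u) (Sum.map₁ (punchIn j) v) ≡ diagonalEntry (minor₀ A j) C u v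
    minor-⊕ j (inj₁ _) (inj₁ _) = ≡.refl
    minor-⊕ j (inj₁ _) (inj₂ _) = ≡.refl
    minor-⊕ j (inj₂ _) (inj₁ _) = ≡.refl
    minor-⊕ j (inj₂ _) (inj₂ _) = ≡.refl

    left : ∀ j → term (j ↑ˡ n) ≈ (sgn j * (A zero j * det (minor₀ A j))) * det C
    left j = begin
      term (j ↑ˡ n)
        ≈⟨ *-cong (reflexive (≡.cong ((- 1#) ^_) (Fin.toℕ-↑ˡ j n)))
             (*-cong (reflexive (≡.cong (diagonalEntry A C (inj₁ zero)) (Fin.splitAt-↑ˡ (suc m) j n)))
                     (trans (det-cong minor≋) (det-⊕ (minor₀ A j) C))) ⟩
      sgn j * (A zero j * (det (minor₀ A j) * det C))
        ≈⟨ trans (*-congˡ (sym (*-assoc _ _ _))) (sym (*-assoc _ _ _)) ⟩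
      (sgn j * (A zero j * det (minor₀ A j))) * det C ∎
      where
      minor≋ : ∀ p q → minor₀ (A ⊕ C) (j ↑ˡ n) p q ≈ (minor₀ A j ⊕ C) p q
      minor≋ p q = reflexive (≡.trans
        (≡.cong (diagonalEntry A C (Sum.map₁ suc (splitAt m p))) (splitAt-punchIn n j q))
        (minor-⊕ j (splitAt m p) (splitAt m q)))

    right : ∀ j → term (suc m ↑ʳ j) ≈ 0#
    right j = trans (*-congˡ (trans (*-congʳ (reflexive
      (≡.cong (diagonalEntry A C (inj₁ zero)) (Fin.splitAt-↑ʳ (suc m) n j)))) (zeroˡ _))) (zeroʳ _)

  BlockMatrix : ℕ → ℕ → Set c
  BlockMatrix N m = Fin N → Fin N → SquareMatrix m

  -- Matches the indexing of `F`, so that `F N m x` is definitionally `flatten (block x)`.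
  flatten : ∀ {N m} → BlockMatrix N m → SquareMatrix (N ℕ.* m)
  flatten {N} {m} M k l =
    M (proj₁ (remQuot {N} m k)) (proj₁ (remQuot {N} m l))
      (proj₂ (remQuot {N} m k)) (proj₂ (remQuot {N} m l))

  blockDiagonal : ∀ {N m} → (Fin N → SquareMatrix m) → SquareMatrix (N ℕ.* m)
  blockDiagonal T = flatten λ r s p q → δ r s * T r p q

  det-flatten-cong : ∀ {N m} {M M′ : BlockMatrix N m} → (∀ r s p q → M r s p q ≈ M′ r s p q) →
    det (flatten M) ≈ det (flatten M′)
  det-flatten-cong {N} {m} {M} {M′} M≈M′ = det-cong {A = flatten M} {flatten M′} λ k l →
    M≈M′ (proj₁ (remQuot {N} m k)) (proj₁ (remQuot {N} m l))
         (proj₂ (remQuot {N} m k)) (proj₂ (remQuot {N} m l))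

  det-blockDiagonal : ∀ {N m} (T : Fin N → SquareMatrix m) → det (blockDiagonal T) ≈ ∏ λ r → det (T r)
  det-blockDiagonal {zero} T = refl
  det-blockDiagonal {suc N} {m} T = begin
    det (blockDiagonal T)                            ≈⟨ det-cong peel ⟩
    det (T zero ⊕ blockDiagonal (T ∘ suc))           ≈⟨ det-⊕ (T zero) (blockDiagonal (T ∘ suc)) ⟩
    det (T zero) * det (blockDiagonal (T ∘ suc))     ≈⟨ *-congˡ (det-blockDiagonal (T ∘ suc)) ⟩
    det (T zero) * ∏ (λ r → det (T (suc r)))         ∎
    where
    peel : ∀ k l → blockDiagonal T k l ≈ (T zero ⊕ blockDiagonal (T ∘ suc)) k l
    peel k l with splitAt m k | splitAt m l
    ... | inj₁ p | inj₁ q = *-identityˡ _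
    ... | inj₁ p | inj₂ l = zeroˡ _
    ... | inj₂ k | inj₁ q = zeroˡ _
    ... | inj₂ k | inj₂ l = refl

  ∑-remQuot : ∀ {N m} (t : Fin N → Fin m → Carrier) →
    ∑ (λ k → t (proj₁ (remQuot {N} m k)) (proj₂ (remQuot {N} m k))) ≈ ∑ λ r → ∑ (t r)
  ∑-remQuot {zero} t = trans (∑-empty _) (sym (∑-empty _))
  ∑-remQuot {suc N} {m} t = begin
    ∑ t′                                                  ≈⟨ ∑-splitAt m t′ ⟩
    ∑ (λ p → t′ (p ↑ˡ (N ℕ.* m))) + ∑ (λ k → t′ (m ↑ʳ k))  ≈⟨ +-cong (∑-cong left) (∑-cong right) ⟩
    ∑ (t zero) + ∑ (λ k → t (suc (proj₁ (remQuot {N} m k))) (proj₂ (remQuot {N} m k)))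
                                                          ≈⟨ +-congˡ (∑-remQuot (t ∘ suc)) ⟩
    ∑ (t zero) + ∑ (λ r → ∑ (t (suc r)))                  ≈⟨ ∑-suc _ ⟨
    ∑ (λ r → ∑ (t r))                                     ∎
    where
    t′ : Vector Carrier (suc N ℕ.* m)
    t′ k = t (proj₁ (remQuot {suc N} m k)) (proj₂ (remQuot {suc N} m k))

    left : ∀ p → t′ (p ↑ˡ (N ℕ.* m)) ≈ t zero p
    left p rewrite Fin.splitAt-↑ˡ m p (N ℕ.* m) = refl

    right : ∀ k → t′ (m ↑ʳ k) ≈ t (suc (proj₁ (remQuot {N} m k))) (proj₂ (remQuot {N} m k))
    right k rewrite Fin.splitAt-↑ʳ m (N ℕ.* m) k = refl

  module _ {N m} (T : Fin N → SquareMatrix m) (M : BlockMatrix N m) where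

    det-blockDiagonal-⊡ : det (flatten λ r s p q → ∑ λ p′ → T r p p′ * M r s p′ q) ≈
      (∏ λ r → det (T r)) * det (flatten M)
    det-blockDiagonal-⊡ = begin
      det (flatten λ r s p q → ∑ λ p′ → T r p p′ * M r s p′ q) ≈⟨ det-flatten-cong product ⟨
      det (blockDiagonal T ⊡ flatten M)                        ≈⟨ det-⊡ (blockDiagonal T) (flatten M) ⟩
      det (blockDiagonal T) * det (flatten M)                  ≈⟨ *-congʳ (det-blockDiagonal T) ⟩
      (∏ λ r → det (T r)) * det (flatten M)                    ∎
      where
      product : ∀ r s p q → ∑ {N ℕ.* m} (λ k → (δ r (proj₁ (remQuot {N} m k)) * T r p (proj₂ (remQuot {N} m k))) *
                  M (proj₁ (remQuot {N} m k)) s (proj₂ (remQuot {N} m k)) q) ≈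
                ∑ λ p′ → T r p p′ * M r s p′ q
      product r s p q = begin
        _                                                            ≈⟨ ∑-remQuot (λ r′ p′ → (δ r r′ * T r p p′) * M r′ s p′ q) ⟩
        ∑ (λ r′ → ∑ λ p′ → (δ r r′ * T r p p′) * M r′ s p′ q)        ≈⟨ ∑-cong (λ r′ → trans (∑-cong λ p′ → *-assoc _ _ _) (sym (*-∑ _ _))) ⟩
        ∑ (λ r′ → δ r r′ * ∑ λ p′ → T r p p′ * M r′ s p′ q)          ≈⟨ ∑-δ-* _ r ⟩
        ∑ (λ p′ → T r p p′ * M r s p′ q)                             ∎

    det-⊡-blockDiagonal : det (flatten λ r s p q → ∑ λ q′ → M r s p q′ * T s q′ q) ≈
      det (flatten M) * ∏ λ r → det (T r)
    det-⊡-blockDiagonal = begin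
      det (flatten λ r s p q → ∑ λ q′ → M r s p q′ * T s q′ q) ≈⟨ det-flatten-cong product ⟨
      det (flatten M ⊡ blockDiagonal T)                        ≈⟨ det-⊡ (flatten M) (blockDiagonal T) ⟩
      det (flatten M) * det (blockDiagonal T)                  ≈⟨ *-congˡ (det-blockDiagonal T) ⟩
      det (flatten M) * (∏ λ r → det (T r))                    ∎
      where
      product : ∀ r s p q → ∑ {N ℕ.* m} (λ k → M r (proj₁ (remQuot {N} m k)) p (proj₂ (remQuot {N} m k)) *
                  (δ (proj₁ (remQuot {N} m k)) s * T (proj₁ (remQuot {N} m k)) (proj₂ (remQuot {N} m k)) q)) ≈
                ∑ λ q′ → M r s p q′ * T s q′ q
      product r s p q = begin
        _                                                            ≈⟨ ∑-remQuot (λ s′ q′ → M r s′ p q′ * (δ s′ s * T s′ q′ q)) ⟩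
        ∑ (λ s′ → ∑ λ q′ → M r s′ p q′ * (δ s′ s * T s′ q′ q))       ≈⟨ ∑-cong (λ s′ → trans
                                                                          (∑-cong λ q′ → solve 3 (λ x d t → x :* (d :* t) := (x :* t) :* d) refl _ _ _)
                                                                          (sym (∑-* _ _))) ⟩
        ∑ (λ s′ → (∑ λ q′ → M r s′ p q′ * T s′ q′ q) * δ s′ s)       ≈⟨ ∑-*-δ _ s ⟩
        ∑ (λ q′ → M r s p q′ * T s q′ q)                             ∎

  det-diagonalBlocks : ∀ {N m} (Y : Fin m → SquareMatrix N) →
    det (flatten {N} {m} λ r s p q → δ p q * Y p r s) ≈ ∏ λ p → det (Y p)
  det-diagonalBlocks {N} {m} Y = begin
    det (flatten {N} {m} λ r s p q → δ p q * Y p r s)            ≈⟨ det-cong entries ⟨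
    det (λ k l → blockDiagonal Y (π k) (π l))                    ≈⟨ det-reindex (ℕ.*-comm N m) π π-injective (blockDiagonal Y) ⟩
    det (blockDiagonal Y)                                        ≈⟨ det-blockDiagonal Y ⟩
    (∏ λ p → det (Y p))                                          ∎
    where
    -- Interchanges the block index and the inner index: `r * m + p` goes to `p * N + r`.
    π : Fin (N ℕ.* m) → Fin (m ℕ.* N)
    π k = combine (proj₂ (remQuot {N} m k)) (proj₁ (remQuot {N} m k))

    π-injective : ∀ {i j} → π i ≡ π j → i ≡ j
    π-injective {i} {j} πi≡πj 
      with p≡ , r≡ ← Fin.combine-injective (proj₂ (remQuot {N} m i)) _ _ _ πi≡πj =
      ≡.trans (≡.sym (Fin.combine-remQuot {N} m i)) (≡.trans (≡.cong₂ combine r≡ p≡) (Fin.combine-remQuot {N} m j))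

    entries : ∀ k l → blockDiagonal Y (π k) (π l) ≈ flatten {N} {m} (λ r s p q → δ p q * Y p r s) k l
    entries k l = reflexive (≡.cong₂
      (λ (a b : Fin m × Fin N) → δ (proj₁ a) (proj₁ b) * Y (proj₁ a) (proj₂ a) (proj₂ b))
      (Fin.remQuot-combine (proj₂ (remQuot {N} m k)) _)
      (Fin.remQuot-combine (proj₂ (remQuot {N} m l)) _))

  -- The factors of F

  -- U p k = [p ≤ k].
  U : ∀ {m} → SquareMatrix m
  U zero    _       = 1#
  U (suc _) zero    = 0#
  U (suc p) (suc k) = U p k

  U-≤ : ∀ {m} {p q : Fin m} → toℕ p ≤ toℕ q → ∀ k → U p k * U q k ≈ U q k
  U-≤ {p = zero}  _ k = *-identityˡ _
  U-≤ {p = suc p} {suc q} p≤q zero = zeroˡ _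
  U-≤ {p = suc p} {suc q} (ℕ.s≤s p≤q) (suc k) = U-≤ p≤q k

  -- An index `k` is above both `p` and `q` exactly when it is above their maximum; this is how the
  -- maximum in the entries of `B` and `D` arises from a product of triangular matrices.
  U-max : ∀ {m} (p q k : Fin m) → U p k * U q k ≈ U (max p q) k
  U-max {m} p q k with Fin.≤-total p q
  ... | inj₁ p≤q rewrite Max.x≤y⇒x⊔y≈y (Fin.≤-totalOrder m) p≤q = U-≤ p≤q k
  ... | inj₂ q≤p rewrite Max.x≤y⇒y⊔x≈y (Fin.≤-totalOrder m) q≤p = trans (*-comm _ _) (U-≤ q≤p k)

  telescope : ∀ {m} (y : Vector Carrier (suc m)) →
    ∑ (λ k → y (inject₁ k) - y (suc k)) ≈ y zero - y (fromℕ m)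
  telescope {zero} y = trans (∑-empty _) (sym (-‿inverseʳ _))
  telescope {suc m} y = begin
    ∑ (λ k → y (inject₁ k) - y (suc k))                         ≈⟨ ∑-suc _ ⟩
    (y zero - y (suc zero)) + ∑ (λ k → y (suc (inject₁ k)) - y (suc (suc k)))
                                                                ≈⟨ +-congˡ (telescope (y ∘ suc)) ⟩
    (y zero - y (suc zero)) + (y (suc zero) - y (fromℕ (suc m))) ≈⟨ +-assoc _ _ _ ⟩
    y zero + (- y (suc zero) + (y (suc zero) - y (fromℕ (suc m)))) ≈⟨ +-congˡ (trans (sym (+-assoc _ _ _)) (trans (+-congʳ (-‿inverseˡ _)) (+-identityˡ _))) ⟩
    y zero - y (fromℕ (suc m))                                  ∎

  -- The row `U w` discards the differences before `w`, so the telescoping sum starts at `w`.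
  U-telescope : ∀ {m} (y : Vector Carrier (suc m)) w →
    ∑ (λ k → U w k * (y (inject₁ k) - y (suc k))) ≈ y (inject₁ w) - y (fromℕ m)
  U-telescope y zero = trans (∑-cong λ k → *-identityˡ _) (telescope y)
  U-telescope {suc m} y (suc w) = begin
    ∑ (λ k → U (suc w) k * (y (inject₁ k) - y (suc k)))         ≈⟨ ∑-suc _ ⟩
    0# * (y zero - y (suc zero)) + ∑ (λ k → U w k * (y (suc (inject₁ k)) - y (suc (suc k))))
                                                                ≈⟨ +-cong (zeroˡ _) (U-telescope (y ∘ suc) w) ⟩
    0# + (y (suc (inject₁ w)) - y (fromℕ (suc m)))              ≈⟨ +-identityˡ _ ⟩
    y (suc (inject₁ w)) - y (fromℕ (suc m))                     ∎

  punchIn-fromℕ : ∀ {m} (q : Fin m) → punchIn (fromℕ m) q ≡ inject₁ q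
  punchIn-fromℕ zero    = ≡.refl
  punchIn-fromℕ (suc q) = ≡.cong suc (punchIn-fromℕ q)

  extend-inject₁ : ∀ {m} (x : Vector Carrier m) i → extend x (inject₁ i) ≡ x i
  extend-inject₁ {m} x i = ≡.trans (≡.cong (extend x) (≡.sym (punchIn-fromℕ i))) (insertAt-punchIn x (fromℕ m) 0# i)

  ∑-U-extend : ∀ {m} (x : Vector Carrier m) p q →
    ∑ (λ k → U p k * ((extend x (inject₁ k) - extend x (suc k)) * U q k)) ≈ x (max p q)
  ∑-U-extend {m} x p q = begin
    ∑ (λ k → U p k * ((extend x (inject₁ k) - extend x (suc k)) * U q k))
      ≈⟨ ∑-cong (λ k → trans (solve 3 (λ u y v → u :* (y :* v) := (u :* v) :* y) refl _ _ _) (*-congʳ (U-max p q k))) ⟩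
    ∑ (λ k → U (max p q) k * (extend x (inject₁ k) - extend x (suc k)))
      ≈⟨ U-telescope (extend x) (max p q) ⟩
    extend x (inject₁ (max p q)) - extend x (fromℕ m)
      -- The convention that the entry after the last is zero removes the end term of the
      -- telescoping sum.
      ≡⟨ ≡.cong₂ _-_ (extend-inject₁ x (max p q)) (insertAt-lookup x (fromℕ m) 0#) ⟩
    x (max p q) - 0#
      ≈⟨ trans (+-congˡ -0#≈0#) (+-identityʳ _) ⟩
    x (max p q) ∎

  -- Determinants of the triangular factors

  -- The first row of `U` consists of ones, whereas that of its transpose has a single nonzero
  -- entry, so the expansion of the transpose has one term.
  det-Uᵀ : ∀ m → det (flip (U {m})) ≈ 1#
  det-Uᵀ zero    = refl
  det-Uᵀ (suc m) = begin
    det (flip (U {suc m}))          ≈⟨ det-single-entry (flip (U {suc m})) zero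
                                         (λ { {zero} 0≢0 → contradiction ≡.refl 0≢0 ; {suc k} _ → refl }) ⟩
    1# * (1# * det (flip (U {m})))  ≈⟨ trans (*-identityˡ _) (*-identityˡ _) ⟩
    det (flip (U {m}))              ≈⟨ det-Uᵀ m ⟩
    1#                              ∎

  reversedU : ∀ {m} → SquareMatrix m
  reversedU p = U (opposite p)

  U-fromℕ : ∀ {m} {k : Fin (suc m)} → k ≢ fromℕ m → U (fromℕ m) k ≡ 0#
  U-fromℕ {zero}  {zero}  k≢ = contradiction ≡.refl k≢
  U-fromℕ {suc m} {zero}  k≢ = ≡.refl
  U-fromℕ {suc m} {suc k} k≢ = U-fromℕ (k≢ ∘ ≡.cong suc)

  U-fromℕ-refl : ∀ m → U (fromℕ m) (fromℕ m) ≡ 1#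
  U-fromℕ-refl zero    = ≡.refl
  U-fromℕ-refl (suc m) = U-fromℕ-refl m

  U-inject₁ : ∀ {m} (p k : Fin m) → U (inject₁ p) (inject₁ k) ≡ U p k
  U-inject₁ zero    k       = ≡.refl
  U-inject₁ (suc p) zero    = ≡.refl
  U-inject₁ (suc p) (suc k) = U-inject₁ p k

  -- The first row is the last row of `U`, whose only nonzero entry is in the last column, of
  -- 0-based index `m`. The corresponding minor is the same matrix one size smaller.
  det-reversedU-suc : ∀ m → det (reversedU {suc m}) ≈ (- 1#) ^ m * det (reversedU {m})
  det-reversedU-suc m = begin
    det (reversedU {suc m})
      ≈⟨ det-single-entry (reversedU {suc m}) (fromℕ m) (reflexive ∘ U-fromℕ) ⟩
    sgn (fromℕ m) * (U (fromℕ m) (fromℕ m) * det (minor₀ (reversedU {suc m}) (fromℕ m)))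
      ≈⟨ *-cong (reflexive (≡.cong ((- 1#) ^_) (Fin.toℕ-fromℕ m)))
           (trans (*-cong (reflexive (U-fromℕ-refl m)) (det-cong minor)) (*-identityˡ _)) ⟩
    (- 1#) ^ m * det (reversedU {m}) ∎
    where
    minor : ∀ p q → minor₀ (reversedU {suc m}) (fromℕ m) p q ≈ reversedU p q
    minor p q = reflexive (≡.trans (≡.cong (U (inject₁ (opposite p))) (punchIn-fromℕ q)) (U-inject₁ (opposite p) q))

  sign-squared : ∀ m → (- 1#) ^ m * (- 1#) ^ m ≈ 1#
  sign-squared zero    = *-identityˡ _
  sign-squared (suc m) = begin
    (- 1# * s) * (- 1# * s)   ≈⟨ *-cong (-1*x≈-x s) (-1*x≈-x s) ⟩
    - s * - s                 ≈⟨ -‿distribˡ-* s (- s) ⟨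
    - (s * - s)               ≈⟨ -‿cong (-‿distribʳ-* s s) ⟨
    - - (s * s)               ≈⟨ -‿involutive _ ⟩
    s * s                     ≈⟨ sign-squared m ⟩
    1#                        ∎
    where s = (- 1#) ^ m

  -- Two consecutive sizes contribute the signs of exponents `suc m` and `m`, whose product is
  -- `- 1#`; hence the recursion in steps of two.
  det-reversedU : ∀ m → det (reversedU {m}) ≈ (- 1#) ^ ⌊ m /2⌋
  det-reversedU zero          = refl
  det-reversedU (suc zero)    = trans (det-reversedU-suc zero) (*-identityˡ _)
  det-reversedU (suc (suc m)) = begin
    det (reversedU {suc (suc m)})                   ≈⟨ trans (det-reversedU-suc (suc m)) (*-congˡ (det-reversedU-suc m)) ⟩
    (- 1# * s) * (s * det (reversedU {m}))          ≈⟨ solve 3 (λ e s d → (e :* s) :* (s :* d) := e :* ((s :* s) :* d)) refl _ _ _ ⟩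
    - 1# * ((s * s) * det (reversedU {m}))          ≈⟨ *-congˡ (*-cong (sign-squared m) (det-reversedU m)) ⟩
    - 1# * (1# * (- 1#) ^ ⌊ m /2⌋)                  ≈⟨ *-congˡ (*-identityˡ _) ⟩
    (- 1#) ^ ⌊ suc (suc m) /2⌋                      ∎
    where s = (- 1#) ^ m

  rowFactor : ∀ {N m} → Fin N → SquareMatrix m
  rowFactor r = if does (2 ∣? suc (toℕ r)) then reversedU else U

  ∏-det-rowFactor : ∀ N m → ∏ (λ (r : Fin N) → det (rowFactor {m = m} r)) ≈ ((- 1#) ^ ⌊ m /2⌋) ^ ⌊ N /2⌋
  ∏-det-rowFactor zero          m = refl
  ∏-det-rowFactor (suc zero)    m = trans (*-identityʳ _) (trans (sym (det-transpose {m} U)) (det-Uᵀ m))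
  -- One `U` and one `reversedU` are split off. The parity test computes with period two, so the
  -- remaining product is definitionally the one for `N`.
  ∏-det-rowFactor (suc (suc N)) m = begin
    det (U {m}) * (det (reversedU {m}) * ∏ (λ (r : Fin N) → det (rowFactor {m = m} r)))
      ≈⟨ *-cong (trans (sym (det-transpose {m} U)) (det-Uᵀ m)) (*-cong (det-reversedU m) (∏-det-rowFactor N m)) ⟩
    1# * (((- 1#) ^ ⌊ m /2⌋) ^ ⌊ suc (suc N) /2⌋) ≈⟨ *-identityˡ _ ⟩
    ((- 1#) ^ ⌊ m /2⌋) ^ ⌊ suc (suc N) /2⌋        ∎

  ∏-one : ∀ {n} {t : Vector Carrier n} → (∀ i → t i ≈ 1#) → ∏ t ≈ 1#
  ∏-one {zero}  t≈1 = refl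
  ∏-one {suc n} t≈1 = trans (*-cong (t≈1 zero) (∏-one (t≈1 ∘ suc))) (*-identityˡ _)

  module _ {N m} (x : Fin N → Fin N → Vector Carrier m) where

    block-factorisation : ∀ r s p q →
      ∑ (λ k → rowFactor r p k * (∑ λ l → (δ k l * X x k r s) * U q l)) ≈ block x r s p q
    block-factorisation r s p q = trans (∑-cong λ k → *-congˡ (diagonal k)) split
      where
      diagonal : ∀ k → ∑ (λ l → (δ k l * X x k r s) * U q l) ≈ X x k r s * U q k
      diagonal k = trans (∑-cong λ l → *-assoc _ _ _) (∑-δ-* _ k)

      split : ∑ (λ k → rowFactor r p k * (X x k r s * U q k)) ≈ block x r s p q
      -- The blocks `D` and `B` differ only in having `opposite p` for `p`, and so do the two row
      -- factors, so one identity serves both cases.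
      split with does (2 ∣? suc (toℕ r))
      ... | true  = ∑-U-extend (x r s) (opposite p) q
      ... | false = ∑-U-extend (x r s) p q

    det-F : det (F N m x) ≈ (- 1#) ^ (⌊ m /2⌋ ℕ.* ⌊ N /2⌋) * ∏ (λ i → det (X x i))
    det-F = begin
      det (F N m x)
        ≈⟨ det-flatten-cong block-factorisation ⟨
      det (flatten λ r s p q → ∑ λ k → rowFactor r p k * DUᵀ r s k q)
        ≈⟨ det-blockDiagonal-⊡ {N} {m} rowFactor DUᵀ ⟩
      ∏ (λ (r : Fin N) → det (rowFactor {m = m} r)) * det (flatten DUᵀ)
        ≈⟨ *-cong (trans (∏-det-rowFactor N m) (^-assocʳ _ ⌊ m /2⌋ ⌊ N /2⌋)) (det-⊡-blockDiagonal (λ _ → flip U) Diag) ⟩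
      (- 1#) ^ (⌊ m /2⌋ ℕ.* ⌊ N /2⌋) * (det (flatten Diag) * ∏ (λ (r : Fin N) → det (flip (U {m}))))
        ≈⟨ *-congˡ (*-cong (det-diagonalBlocks (X x)) (∏-one {N} λ _ → det-Uᵀ m)) ⟩
      (- 1#) ^ (⌊ m /2⌋ ℕ.* ⌊ N /2⌋) * (∏ (λ i → det (X x i)) * 1#)
        ≈⟨ *-congˡ (*-identityʳ _) ⟩
      (- 1#) ^ (⌊ m /2⌋ ℕ.* ⌊ N /2⌋) * ∏ (λ i → det (X x i)) ∎
      where
      Diag DUᵀ : BlockMatrix N m
      Diag r s p q = δ p q * X x p r s
      DUᵀ r s p q = ∑ λ l → Diag r s p l * U q l

-- The exponent of the sign

even-halves : ∀ {n} → 2 ∣ n → n ≡ ⌊ n /2⌋ ℕ.* 2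
even-halves {n} (divides k ≡.refl) = ≡.cong (ℕ._* 2) (half k)
  where
  half : ∀ k → k ≡ ⌊ k ℕ.* 2 /2⌋
  half zero    = ≡.refl
  half (suc k) = ≡.cong suc (half k)

odd-halves : ∀ n → ¬ (2 ∣ n) → n ∸ 1 ≡ ⌊ n /2⌋ ℕ.* 2
odd-halves zero          2∤n = contradiction (divides 0 ≡.refl) 2∤n
odd-halves (suc zero)    2∤n = ≡.refl
odd-halves (suc (suc zero)) 2∤n = contradiction (divides 1 ≡.refl) 2∤n
odd-halves (suc (suc (suc n))) 2∤n = ≡.cong (λ k → suc (suc k)) (odd-halves (suc n) λ { (divides k eq) →
  2∤n (divides (suc k) (≡.cong (λ k → suc (suc k)) eq)) })

-- Here `a` stands for `N` or `N ∸ 1` and `b` for `m` or `m ∸ 1`, whichever is even, so the division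
-- by 4 is exact and all four cases are treated at once.
quarter : ∀ {a b} N m → a ≡ ⌊ N /2⌋ ℕ.* 2 → b ≡ ⌊ m /2⌋ ℕ.* 2 → ⌊ m /2⌋ ℕ.* ⌊ N /2⌋ ≡ (a ℕ.* b) / 4
quarter N m ≡.refl ≡.refl = ≡.sym (≡.trans (/-congˡ (rearrange ⌊ N /2⌋ ⌊ m /2⌋)) (m*n/n≡m (⌊ m /2⌋ ℕ.* ⌊ N /2⌋) 4))
  where
  rearrange : ∀ h k → (h ℕ.* 2) ℕ.* (k ℕ.* 2) ≡ (k ℕ.* h) ℕ.* 4
  rearrange = solve 2 (λ h k → (h :* con 2) :* (k :* con 2) := (k :* h) :* con 4) ≡.refl
    where open +-*-Solver

theorem3p3 : ∀ {c ℓ} (R : CommutativeRing c ℓ) →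
  let open CommutativeRing R
      open BlockDet R
  in (N m : ℕ) → 2 ≤ N → 1 ≤ m →
     (x : Fin N → Fin N → Vector Carrier m) →
     (2 ∣ N → 2 ∣ m →
        det (F N m x) ≈ (- 1#) ^ ((N ℕ.* m) / 4) * ∏ (λ i → det (X x i)))
     × (2 ∣ N → ¬ (2 ∣ m) →
        det (F N m x) ≈ (- 1#) ^ ((N ℕ.* (m ∸ 1)) / 4) * ∏ (λ i → det (X x i)))
     × (¬ (2 ∣ N) → 2 ∣ m →
        det (F N m x) ≈ (- 1#) ^ (((N ∸ 1) ℕ.* m) / 4) * ∏ (λ i → det (X x i)))
     × (¬ (2 ∣ N) → ¬ (2 ∣ m) →
        det (F N m x) ≈ (- 1#) ^ (((N ∸ 1) ℕ.* (m ∸ 1)) / 4) * ∏ (λ i → det (X x i)))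
theorem3p3 R N m _ _ x =
    (λ 2∣N 2∣m → signed (even-halves 2∣N) (even-halves 2∣m))
  , (λ 2∣N 2∤m → signed (even-halves 2∣N) (odd-halves m 2∤m))
  , (λ 2∤N 2∣m → signed (odd-halves N 2∤N) (even-halves 2∣m))
  , (λ 2∤N 2∤m → signed (odd-halves N 2∤N) (odd-halves m 2∤m))
  where
  open CommutativeRing R
  open BlockDet R
  signed : ∀ {a b} → a ≡ ⌊ N /2⌋ ℕ.* 2 → b ≡ ⌊ m /2⌋ ℕ.* 2 →
    det (F N m x) ≈ (- 1#) ^ ((a ℕ.* b) / 4) * ∏ (λ i → det (X x i))
  signed a≡ b≡ = trans (Determinant.det-F R x) (*-congʳ (reflexive (≡.cong ((- 1#) ^_) (quarter N m a≡ b≡))))
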